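{- Let $n\ge 5$ be an integer and let $Y$ be a graph on $n$ vertices with minimum degree $\delta(Y)=n-4$. Then the friends-and-strangers graph $\mathsf{FS}(\mathsf{Lollipop}_{n-5,5},Y)$ is connected if and only if $Y$ does not contain any induced subgraph isomorphic to $\mathsf{Complete}_3\cup\mathsf{Path}_2$ or to $\mathsf{Path}_3\cup\mathsf{Path}_2$.
   Context: All graphs are finite and simple (no loops, no multiple edges). Friends-and-strangers graph: for two graphs $X$ and $Y$, each with $n$ vertices, $\mathsf{FS}(X,Y)$ is the graph whose vertices are all bijections $\sigma:V(X)\to V(Y)$, where two bijections $\sigma,\sigma'$ are adjacent if and only if there is an edge $\{a,b\}\in E(X)$ such that $\{\sigma(a),\sigma(b)\}\in E(Y)$, $\sigma(a)=\sigma'(b)$, $\sigma(b)=\sigma'(a)$, and $\sigma(c)=\sigma'(c)$ for all $c\in V(X)\setminus\{a,b\}$. Lollipop graph: for $2\le k\le n$, $\mathsf{Lollipop}_{n-k,k}$ is the graph of order $n$ obtained by identifying one end of a path with $n-k+1$ vertices with a vertex of a complete graph on $k$ vertices. Concretely, it has vertex set $\{1,\dots,n\}$, with edges $\{i,i+1\}$ for $1\le i\le n-k$ together with all edges $\{i,j\}$ with $n-k+1\le i<j\le n$. (For $k=n$ it is the complete graph on $n$ vertices.) $\mathsf{Path}_m$ and $\mathsf{Complete}_m$ denote the path and the complete graph with $m$ vertices, respectively, and $G\cup H$ denotes the disjoint union of graphs $G$ and $H$. -}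

module Defs where

open import Data.Fin.Base using (Fin; toℕ)
open import Data.Fin.Permutation using (Permutation; _⟨$⟩ʳ_)
open import Data.Fin.Properties using (_≟_; any?; all?; ≡-setoid)
open import Data.Fin.Subset using (Subset; _∈_; ∣_∣)
open import Data.List.Base as List using ()
open import Data.List.Extrema.Nat using (min)
open import Data.Nat.Base using (ℕ; suc; _∸_; _≤_; _<_)
import Data.Nat.Properties as ℕ
open import Data.Product.Base using (Σ; ∃-syntax; _×_; _,_; proj₁)
open import Data.Sum.Base using (_⊎_; inj₁; inj₂; swap)
open import Data.Sum.Relation.Binary.Pointwise
  using (Pointwise; ⊎-setoid; ⊎-symmetric; ⊎-irreflexive; ⊎-decidable; ⊎-respects₂)
open import Data.Vec.Base as Vec using ()
open import Function.Bundles using (Inverse; _⇔_)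
open import Level using (0ℓ)
open import Relation.Binary.Bundles using (Setoid)
open import Relation.Binary.Construct.Closure.ReflexiveTransitive using (Star)
import Relation.Binary.Construct.On as On
open import Relation.Binary.Core using (Rel)
open import Relation.Binary.Definitions
  using (Symmetric; Irreflexive; Decidable; _Respects₂_)
open import Relation.Binary.PropositionalEquality
  using (_≡_; _≢_; refl; sym; trans; subst; resp₂; ≢-sym; _≗_)
open import Relation.Nullary using (does)
open import Relation.Nullary.Decidable using (¬?; _×-dec_; _⊎-dec_; _→-dec_)

-- Vertices form a setoid because the vertices of FS X Y are bijections, which
-- are to be identified when they agree pointwise.
record Graph (V : Setoid 0ℓ 0ℓ) : Set₁ where
  open Setoid V using (_≈_) renaming (Carrier to Vertex)
  field
    Adj        : Rel Vertex 0ℓ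
    adj-sym    : Symmetric Adj
    adj-irrefl : Irreflexive _≈_ Adj
    adj-resp   : Adj Respects₂ _≈_
    adj?       : Decidable Adj

open Graph public

GraphOn : ℕ → Set₁
GraphOn n = Graph (≡-setoid n)

record _≅_ {V W : Setoid 0ℓ 0ℓ} (G : Graph V) (H : Graph W) : Set where
  field
    bijection : Inverse V W
  open Inverse bijection public using (to; from)
  field
    adj⇔adj : ∀ u v → Adj G u v ⇔ Adj H (to u) (to v)

-- The target of the walk is only required up to the vertex equality.
Connected : {V : Setoid 0ℓ 0ℓ} → Graph V → Set
Connected {V} G = ∀ u v → ∃[ w ] Star (Adj G) u w × w ≈ v
  where open Setoid V using (_≈_)

degree : ∀ {n} → GraphOn n → Fin n → ℕ
degree G v = ∣ Vec.tabulate (λ w → does (adj? G v w)) ∣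

-- Every degree is less than n, so the initial value n does not affect the
-- minimum when n ≥ 1; it only makes δ total (the null graph gets 0).
δ : ∀ {n} → GraphOn n → ℕ
δ {n} G = min n (List.tabulate (degree G))

subsetSetoid : ∀ {n} → Subset n → Setoid 0ℓ 0ℓ
subsetSetoid {n} S = On.setoid {B = Σ (Fin n) (_∈ S)} (≡-setoid n) proj₁

induced : ∀ {n} → GraphOn n → (S : Subset n) → Graph (subsetSetoid S)
induced G S = record
  { Adj        = λ u v → Adj G (proj₁ u) (proj₁ v)
  ; adj-sym    = adj-sym G
  ; adj-irrefl = adj-irrefl G
  ; adj-resp   = (λ { refl e → e }) , (λ { refl e → e })
  ; adj?       = λ u v → adj? G (proj₁ u) (proj₁ v)
  }

HasInduced : ∀ {n} {V : Setoid 0ℓ 0ℓ} → GraphOn n → Graph V → Set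
HasInduced {n} G H = ∃[ S ] induced G S ≅ H

infixr 6 _∪_

_∪_ : {V W : Setoid 0ℓ 0ℓ} → Graph V → Graph W → Graph (⊎-setoid V W)
G ∪ H = record
  { Adj        = Pointwise (Adj G) (Adj H)
  ; adj-sym    = ⊎-symmetric (adj-sym G) (adj-sym H)
  ; adj-irrefl = ⊎-irreflexive (adj-irrefl G) (adj-irrefl H)
  ; adj-resp   = ⊎-respects₂ (adj-resp G) (adj-resp H)
  ; adj?       = ⊎-decidable (adj? G) (adj? H)
  }

Complete : ∀ n → GraphOn n
Complete n = record
  { Adj        = _≢_
  ; adj-sym    = ≢-sym
  ; adj-irrefl = λ i≡j i≢j → i≢j i≡j
  ; adj-resp   = resp₂ _≢_
  ; adj?       = λ i j → ¬? (i ≟ j)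
  }

-- The graph on Fin n whose edges are the pairs {i, j} with i < j and E i j.
fromOrderedEdges : ∀ n (E : Rel ℕ 0ℓ) → Decidable E →
                   (∀ {i j} → E i j → i < j) → GraphOn n
fromOrderedEdges n E E? E⇒< = record
  { Adj        = λ i j → E (toℕ i) (toℕ j) ⊎ E (toℕ j) (toℕ i)
  ; adj-sym    = swap
  ; adj-irrefl = λ { refl (inj₁ e) → ℕ.<-irrefl refl (E⇒< e)
                   ; refl (inj₂ e) → ℕ.<-irrefl refl (E⇒< e) }
  ; adj-resp   = resp₂ _
  ; adj?       = λ i j → E? (toℕ i) (toℕ j) ⊎-dec E? (toℕ j) (toℕ i)
  }

Path : ∀ n → GraphOn n
Path n = fromOrderedEdges n (λ i j → suc i ≡ j) (λ i j → suc i ℕ.≟ j)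
           (λ { refl → ℕ.≤-refl })

-- Lollipop n k is the lollipop graph of order n with a clique of order k, for
-- 2 ≤ k ≤ n.  Vertices are numbered from 0: the first n ∸ k of them form the
-- stick, which ends at the clique vertex n ∸ k.
LollipopEdge : (n k : ℕ) → Rel ℕ 0ℓ
LollipopEdge n k i j = (suc i ≡ j × i < n ∸ k) ⊎ (n ∸ k ≤ i × i < j)

Lollipop : ∀ n k → GraphOn n
Lollipop n k = fromOrderedEdges n (LollipopEdge n k)
  (λ i j → ((suc i ℕ.≟ j) ×-dec (i ℕ.<? n ∸ k))
           ⊎-dec ((n ∸ k ℕ.≤? i) ×-dec (i ℕ.<? j)))
  (λ { (inj₁ (refl , _)) → ℕ.≤-refl ; (inj₂ (_ , i<j)) → i<j })

bijectionSetoid : ℕ → Setoid 0ℓ 0ℓ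
bijectionSetoid n = record
  { Carrier       = Permutation n n
  ; _≈_           = λ σ τ → (σ ⟨$⟩ʳ_) ≗ (τ ⟨$⟩ʳ_)
  ; isEquivalence = record
    { refl  = λ _ → refl
    ; sym   = λ p i → sym (p i)
    ; trans = λ p q i → trans (p i) (q i)
    }
  }

FSAdj : ∀ {n} → GraphOn n → GraphOn n → Rel (Permutation n n) 0ℓ
FSAdj X Y σ σ′ = ∃[ a ] ∃[ b ]
    Adj X a b
  × Adj Y (σ ⟨$⟩ʳ a) (σ ⟨$⟩ʳ b)
  × σ ⟨$⟩ʳ a ≡ σ′ ⟨$⟩ʳ b
  × σ ⟨$⟩ʳ b ≡ σ′ ⟨$⟩ʳ a
  × (∀ c → c ≢ a → c ≢ b → σ ⟨$⟩ʳ c ≡ σ′ ⟨$⟩ʳ c)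

FS : ∀ {n} → GraphOn n → GraphOn n → Graph (bijectionSetoid n)
FS X Y = record
  { Adj        = FSAdj X Y
  ; adj-sym    = λ { (a , b , x , y , p , q , r) →
      a , b , x
      , subst (λ v → Adj Y v _) q (subst (Adj Y _) p (adj-sym Y y))
      , sym q , sym p , λ c c≢a c≢b → sym (r c c≢a c≢b) }
  ; adj-irrefl = λ { σ≈σ′ (a , b , x , y , p , q , r) →
      adj-irrefl Y (trans p (sym (σ≈σ′ b))) y }
  ; adj-resp   =
      (λ { τ≈τ′ (a , b , x , y , p , q , r) →
         a , b , x , y , trans p (τ≈τ′ b) , trans q (τ≈τ′ a)
         , λ c c≢a c≢b → trans (r c c≢a c≢b) (τ≈τ′ c) })
    , (λ { σ≈σ′ (a , b , x , y , p , q , r) →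
         a , b , x
         , subst (λ v → Adj Y v _) (σ≈σ′ a) (subst (Adj Y _) (σ≈σ′ b) y)
         , trans (sym (σ≈σ′ a)) p , trans (sym (σ≈σ′ b)) q
         , λ c c≢a c≢b → trans (sym (σ≈σ′ c)) (r c c≢a c≢b) })
  ; adj?       = λ σ σ′ → any? λ a → any? λ b →
      adj? X a b
      ×-dec adj? Y (σ ⟨$⟩ʳ a) (σ ⟨$⟩ʳ b)
      ×-dec (σ ⟨$⟩ʳ a ≟ σ′ ⟨$⟩ʳ b)
      ×-dec (σ ⟨$⟩ʳ b ≟ σ′ ⟨$⟩ʳ a)
      ×-dec all? λ c → ¬? (c ≟ a) →-dec ¬? (c ≟ b) →-dec
                       (σ ⟨$⟩ʳ c ≟ σ′ ⟨$⟩ʳ c)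
  }

{-# OPTIONS --safe #-}

-- The theorem holds because, for k ≤ n, FS (Lollipop n k) Y is connected exactly
-- when every k vertices of Y induce a connected subgraph, and for δ Y ≥ n − 4
-- and k = 5 a disconnected five-vertex subgraph must be K₃ ∪ P₂ or P₃ ∪ P₂.
--
-- Necessity: let k vertices split into parts A and B with no edges between them.
-- Then "the first of these k persons along the lollipop is in A" is invariant.
-- Along an edge of the stick the first of them is never overtaken, so it could
-- only fail by an exchange within the clique while all k of them are there; but
-- then they fill the clique, and no one else is there to exchange places with.
--
-- Sufficiency: by downward induction on m, arrangements that agree on the first
-- m places are connected.  The persons not placed there induce a connected
-- subgraph of Y, so any of them is reached from the one at place m by a walk.
-- On the stick, the walk is followed by exchanges at places m and m + 1; on the
-- clique, conjugating along the walk realises every transposition.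
module Submission where

open import Defs
open import Data.Bool.Base using (Bool; true; false)
open import Data.Fin.Base
  using (Fin; zero; suc; toℕ; fromℕ<; opposite; inject≤; punchIn; join; splitAt)
open import Data.Fin.Patterns using (0F; 1F; 2F; 3F; 4F)
open import Data.Fin.Permutation
  using (Permutation; _⟨$⟩ʳ_; _⟨$⟩ˡ_; _∘ₚ_; inverseˡ; inverseʳ; transpose)
open import Data.Fin.Permutation.Components using () renaming (transpose to swap)
open import Data.Fin.Properties
  using ( _≟_; all?; any?; ≡-setoid; toℕ-injective; toℕ<n; fromℕ<-injective; toℕ-fromℕ<
        ; injective⇒≤; punchInᵢ≢i; punchIn-injective; opposite-prop; opposite-involutive
        ; toℕ-inject≤; inject≤-injective; suc-injective; join-splitAt)
open import Data.Fin.Subset using (Subset; _∈_; ∣_∣; _-_; ∁)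
open import Data.Fin.Subset.Properties
  using (_∈?_; x∈p∧x≢y⇒x∈p-y; x∈p⇒∣p-x∣<∣p∣; x∉p⇒x∈∁p; ∣∁p∣≡n∸∣p∣)
open import Data.List.Base as List using ()
open import Data.List.Extrema.Nat using (min≤xs)
open import Data.List.Relation.Unary.All.Properties using (tabulate⁻)
open import Data.Maybe.Base using (Maybe; just; nothing)
open import Data.Maybe.Properties using (just-injective)
open import Data.Nat.Base using (ℕ; zero; suc; _+_; _∸_; _≤_; _<_; z≤n; s≤s)
open import Data.Nat.Properties as ℕ using (≤-refl; ≤-trans; <-trans; <-irrefl; ≤-reflexive)
open import Data.Product.Base using (∃-syntax; _×_; _,_; proj₁; proj₂)
open import Data.Sum.Base using (_⊎_; inj₁; inj₂; [_,_]′)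
open import Data.Sum.Relation.Binary.Pointwise using (inj₁; inj₂; ⊎-setoid)
open import Data.Vec.Base as Vec using ()
open import Data.Vec.Functional using (_∷_; [])
open import Data.Vec.Properties using (lookup∘tabulate; []=⇒lookup; lookup⇒[]=)
open import Function.Base using (_∘_; _on_; id)
open import Function.Bundles using (_⇔_; mk⇔; Equivalence; Inverse)
open import Function.Definitions using (Injective)
open import Level using (0ℓ)
open import Relation.Binary.Bundles using (Setoid)
open import Relation.Binary.Construct.Closure.ReflexiveTransitive
  using (Star; ε; _◅_; _◅◅_; gmap; reverse)
open import Relation.Binary.Core using (Rel)
open import Relation.Binary.Definitions using (tri<; tri≈; tri>)
open import Relation.Binary.PropositionalEquality
  using (_≡_; _≢_; refl; sym; trans; cong; subst; subst₂; ≢-sym; module ≡-Reasoning)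
open import Relation.Nullary using (¬_; Dec; does; yes; no; contradiction)
open import Relation.Nullary.Decidable using (dec-true; dec-false; _×-dec_; _⊎-dec_; ¬?)

private
  variable
    k m n p q : ℕ

-- Transpositions

swap-matchˡ : ∀ (i j : Fin n) → swap i j i ≡ j
swap-matchˡ i j rewrite dec-true (i ≟ i) refl = refl

swap-matchʳ : ∀ (i j : Fin n) → swap i j j ≡ i
swap-matchʳ i j with j ≟ i
... | yes j≡i = j≡i
... | no  _   rewrite dec-true (j ≟ j) refl = refl

swap-mismatch : ∀ {i j l : Fin n} → l ≢ i → l ≢ j → swap i j l ≡ l
swap-mismatch {i = i} {j} {l} l≢i l≢j
  rewrite dec-false (l ≟ i) l≢i | dec-false (l ≟ j) l≢j = refl

swap-self : ∀ (i l : Fin n) → swap i i l ≡ l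
swap-self i l with l ≟ i
... | yes refl = refl
... | no  l≢i  rewrite dec-false (l ≟ i) l≢i = refl

-- Reduces transposing the ends `u` and `w` of a walk through `v` to transposing `v` and `w` between
-- two exchanges along the edge from `u` to `v`.
swap-conjugate : ∀ {u v w : Fin n} → u ≢ v → u ≢ w → v ≢ w →
                 ∀ x → swap u v (swap v w (swap u v x)) ≡ swap u w x
swap-conjugate {u = u} {v} {w} u≢v u≢w v≢w x = by-cases (x ≟ u) (x ≟ v) (x ≟ w)
  where
  images : ∀ {a b c} → swap u v x ≡ a → swap v w a ≡ b → swap u v b ≡ c →
           swap u w x ≡ c → swap u v (swap v w (swap u v x)) ≡ swap u w x
  images refl refl refl eq = sym eq

  by-cases : Dec (x ≡ u) → Dec (x ≡ v) → Dec (x ≡ w) →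
             swap u v (swap v w (swap u v x)) ≡ swap u w x
  by-cases (yes refl) _ _ =
    images (swap-matchˡ u v) (swap-matchˡ v w) (swap-mismatch (≢-sym u≢w) (≢-sym v≢w)) (swap-matchˡ u w)
  by-cases (no x≢u) (yes refl) _ =
    images (swap-matchʳ u v) (swap-mismatch u≢v u≢w) (swap-matchˡ u v) (swap-mismatch x≢u v≢w)
  by-cases (no x≢u) (no x≢v) (yes refl) =
    images (swap-mismatch x≢u x≢v) (swap-matchʳ v w) (swap-matchʳ u v) (swap-matchʳ u w)
  by-cases (no x≢u) (no x≢v) (no x≢w) =
    images (swap-mismatch x≢u x≢v) (swap-mismatch x≢v x≢w) (swap-mismatch x≢u x≢v) (swap-mismatch x≢u x≢w)

-- Injections and counting

permutation-injective : ∀ (σ : Permutation n n) {i j} → σ ⟨$⟩ʳ i ≡ σ ⟨$⟩ʳ j → i ≡ j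
permutation-injective σ eq =
  trans (sym (inverseˡ σ)) (trans (cong (σ ⟨$⟩ˡ_) eq) (inverseˡ σ))

permutation-inverse-injective : ∀ (σ : Permutation n n) {x y} → σ ⟨$⟩ˡ x ≡ σ ⟨$⟩ˡ y → x ≡ y
permutation-inverse-injective σ eq =
  trans (sym (inverseʳ σ)) (trans (cong (σ ⟨$⟩ʳ_) eq) (inverseʳ σ))

∷-injective : ∀ {x : Fin n} {f : Fin k → Fin n} → (∀ i → f i ≢ x) →
              Injective _≡_ _≡_ f → Injective _≡_ _≡_ (x ∷ f)
∷-injective fi≢x f-inj {zero}  {zero}  eq = refl
∷-injective fi≢x f-inj {zero}  {suc j} eq = contradiction (sym eq) (fi≢x j)
∷-injective fi≢x f-inj {suc i} {zero}  eq = contradiction eq (fi≢x i)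
∷-injective fi≢x f-inj {suc i} {suc j} eq = cong suc (f-inj eq)

-- An injection takes the value `x` at most once, so it is enough to drop that index, or any index
-- if `x` is not a value.
punchIn-avoiding : ∀ {f : Fin (suc k) → Fin n} → Injective _≡_ _≡_ f → ∀ x →
                   ∃[ j ] (∀ i → f (punchIn j i) ≢ x)
punchIn-avoiding {f = f} f-inj x with any? (λ j → f j ≟ x)
... | yes (j , fj≡x) = j , λ i eq → punchInᵢ≢i j i (f-inj (trans eq (sym fj≡x)))
... | no  ∄j         = zero , λ i eq → ∄j (_ , eq)

injection-∈⇒≤ : ∀ {f : Fin k → Fin n} → Injective _≡_ _≡_ f →
                ∀ S → (∀ i → f i ∈ S) → k ≤ ∣ S ∣
injection-∈⇒≤ {zero}          f-inj S f∈S = z≤n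
injection-∈⇒≤ {suc k} {f = f} f-inj S f∈S =
  ≤-trans (s≤s (injection-∈⇒≤ (suc-injective ∘ f-inj) (S - f zero) λ i →
            x∈p∧x≢y⇒x∈p-y (f∈S (suc i)) λ eq → contradiction (f-inj eq) λ ()))
          (x∈p⇒∣p-x∣<∣p∣ (f∈S zero))

-- Subtracting `m` keeps values that are at least `m` distinct and sends them below `n ∸ m`.
injection-≥⇒≤ : ∀ {f : Fin k → Fin n} → Injective _≡_ _≡_ f →
                (∀ i → m ≤ toℕ (f i)) → k ≤ n ∸ m
injection-≥⇒≤ {m = m} {f = f} f-inj m≤f =
  injective⇒≤ {f = λ i → fromℕ< (f∸m<n∸m i)} λ {i} {j} eq →
    f-inj (toℕ-injective (ℕ.∸-cancelʳ-≡ (m≤f i) (m≤f j)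
      (fromℕ<-injective (toℕ (f i) ∸ m) (toℕ (f j) ∸ m) (f∸m<n∸m i) (f∸m<n∸m j) eq)))
  where
  f∸m<n∸m : ∀ i → toℕ (f i) ∸ m < _ ∸ m
  f∸m<n∸m i = ℕ.∸-monoˡ-< (toℕ<n (f i)) (m≤f i)

-- Edges of the lollipop

lollipop-adj⁻ : ∀ {i j : Fin n} → Adj (Lollipop n k) i j →
                (suc (toℕ i) ≡ toℕ j ⊎ suc (toℕ j) ≡ toℕ i)
              ⊎ (n ∸ k ≤ toℕ i × n ∸ k ≤ toℕ j)
lollipop-adj⁻ (inj₁ (inj₁ (eq , _)))    = inj₁ (inj₁ eq)
lollipop-adj⁻ (inj₁ (inj₂ (n∸k≤i , i<j))) = inj₂ (n∸k≤i , ≤-trans n∸k≤i (ℕ.<⇒≤ i<j))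
lollipop-adj⁻ (inj₂ (inj₁ (eq , _)))    = inj₁ (inj₂ eq)
lollipop-adj⁻ (inj₂ (inj₂ (n∸k≤j , j<i))) = inj₂ (≤-trans n∸k≤j (ℕ.<⇒≤ j<i) , n∸k≤j)

lollipop-clique : ∀ {i j : Fin n} → n ∸ k ≤ toℕ i → n ∸ k ≤ toℕ j → i ≢ j →
                  Adj (Lollipop n k) i j
lollipop-clique {i = i} {j} n∸k≤i n∸k≤j i≢j with ℕ.<-cmp (toℕ i) (toℕ j)
... | tri< i<j _ _ = inj₁ (inj₂ (n∸k≤i , i<j))
... | tri≈ _ i≡j _ = contradiction (toℕ-injective i≡j) i≢j
... | tri> _ _ j<i = inj₂ (inj₂ (n∸k≤j , j<i))

-- Necessity: the invariant of a colouring

-- The two parts are the vertices coloured true and false.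
module Colouring (Y : GraphOn n) (k≤n : k ≤ n) (colour : Fin n → Maybe Bool)
  (no-edge : ∀ x y → Adj Y x y → colour x ≡ just true → colour y ≢ just false)
  (f : Fin k → Fin n) (f-injective : Injective _≡_ _≡_ f)
  (f-coloured : ∀ i → colour (f i) ≢ nothing) where

  -- Expresses that the first coloured person along the lollipop has colour true. The witness need
  -- not be the place of that person: any place coloured true before all those coloured false will
  -- do, so it may be replaced when convenient.
  Precedes : Permutation n n → Set
  Precedes σ = ∃[ i ] colour (σ ⟨$⟩ʳ i) ≡ just true
                    × (∀ j → colour (σ ⟨$⟩ʳ j) ≡ just false → toℕ i < toℕ j)

  precedes-cong : ∀ {σ σ′} →
    (∀ i → colour (σ ⟨$⟩ʳ i) ≡ colour (σ′ ⟨$⟩ʳ i)) → Precedes σ → Precedes σ′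
  precedes-cong eq (i , i-true , i<false) =
    i , trans (sym (eq i)) i-true , λ j j-false → i<false j (trans (eq j) j-false)

  precedes-same-colour : ∀ {σ σ′} ((a , b , _) : FSAdj (Lollipop n k) Y σ σ′) →
    colour (σ ⟨$⟩ʳ a) ≡ colour (σ ⟨$⟩ʳ b) → Precedes σ → Precedes σ′
  precedes-same-colour {σ} {σ′} (a , b , _ , _ , σa≡σ′b , σb≡σ′a , rest) eq = precedes-cong {σ} {σ′} same
    where
    same : ∀ i → colour (σ ⟨$⟩ʳ i) ≡ colour (σ′ ⟨$⟩ʳ i)
    same i with i ≟ a | i ≟ b
    ... | yes refl | _        = trans eq (cong colour σb≡σ′a)
    ... | no _     | yes refl = trans (sym eq) (cong colour σa≡σ′b)
    ... | no i≢a   | no i≢b   = cong colour (rest i i≢a i≢b)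

  -- An exchange of consecutive places that involves an uncoloured person keeps the order of the
  -- coloured ones, and the witness follows its person. An exchange within the clique may leap over
  -- others, so there a witness on the stick is taken, which the exchange does not touch.
  precedes-uncoloured : ∀ {σ σ′} ((a , b , _) : FSAdj (Lollipop n k) Y σ σ′) →
    colour (σ ⟨$⟩ʳ b) ≡ nothing → Precedes σ → Precedes σ′
  precedes-uncoloured {σ} {σ′} (a , b , Xab , _ , σa≡σ′b , σb≡σ′a , rest) b-plain (i , i-true , i<false)
    = [ along-path , within-clique ]′ (lollipop-adj⁻ {k = k} Xab)
    where
    a′-plain : colour (σ′ ⟨$⟩ʳ a) ≡ nothing
    a′-plain = trans (cong colour (sym σb≡σ′a)) b-plain

    unmoved : ∀ {c} → c ≢ a → c ≢ b → colour (σ ⟨$⟩ʳ c) ≡ colour (σ′ ⟨$⟩ʳ c)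
    unmoved c≢a c≢b = cong colour (rest _ c≢a c≢b)

    plain≢coloured : ∀ {x c c′} → colour x ≡ nothing → colour c ≡ just c′ → c ≢ x
    plain≢coloured x-plain c-coloured refl = contradiction (trans (sym x-plain) c-coloured) λ ()

    i≢b : i ≢ b
    i≢b eq = plain≢coloured b-plain i-true (cong (σ ⟨$⟩ʳ_) eq)

    false′⇒≢a : ∀ {j} → colour (σ′ ⟨$⟩ʳ j) ≡ just false → j ≢ a
    false′⇒≢a j-false eq = plain≢coloured a′-plain j-false (cong (σ′ ⟨$⟩ʳ_) eq)

    along-path : suc (toℕ a) ≡ toℕ b ⊎ suc (toℕ b) ≡ toℕ a → Precedes σ′
    along-path a~b with i ≟ a
    ... | yes refl = b , trans (cong colour (sym σa≡σ′b)) i-true , b<false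
      where
      -- No third place lies between the consecutive places `a` and `b`.
      a<j⇒b<j : ∀ {j} → j ≢ b → toℕ a < toℕ j → toℕ b < toℕ j
      a<j⇒b<j j≢b a<j = [ (λ eq → ℕ.≤∧≢⇒< (subst (_≤ _) eq a<j) (j≢b ∘ sym ∘ toℕ-injective))
                       , (λ eq → <-trans (≤-reflexive eq) a<j) ]′ a~b

      b<false : ∀ j → colour (σ′ ⟨$⟩ʳ j) ≡ just false → toℕ b < toℕ j
      b<false j j-false = a<j⇒b<j j≢b (i<false j (trans (unmoved (false′⇒≢a j-false) j≢b) j-false))
        where
        j≢b : j ≢ b
        j≢b refl = contradiction
          (trans (sym i-true) (trans (cong colour σa≡σ′b) j-false)) λ ()
    ... | no i≢a = i , trans (sym (unmoved i≢a i≢b)) i-true , i<false′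
      where
      i<a⇒i<b : toℕ i < toℕ a → toℕ i < toℕ b
      i<a⇒i<b i<a = [ (λ eq → <-trans i<a (≤-reflexive eq))
                    , (λ eq → ℕ.≤∧≢⇒< (ℕ.≤-pred (subst (_ <_) (sym eq) i<a)) (i≢b ∘ toℕ-injective)) ]′ a~b

      i<false′ : ∀ j → colour (σ′ ⟨$⟩ʳ j) ≡ just false → toℕ i < toℕ j
      i<false′ j j-false with j ≟ b
      ... | yes refl = i<a⇒i<b (i<false a (trans (cong colour σa≡σ′b) j-false))
      ... | no j≢b   = i<false j (trans (unmoved (false′⇒≢a j-false) j≢b) j-false)

    -- If no vertex coloured true sat on the stick, then all k coloured
    -- vertices and the uncoloured one at b would share the k places of the clique.
    true-on-stick : n ∸ k ≤ toℕ b → ∃[ c ] toℕ c < n ∸ k × colour (σ ⟨$⟩ʳ c) ≡ just true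
                                     × (∀ j → colour (σ ⟨$⟩ʳ j) ≡ just false → toℕ c < toℕ j)
    true-on-stick n∸k≤b with toℕ i ℕ.<? n ∸ k
    ... | yes i<n∸k = i , i<n∸k , i-true , i<false
    ... | no  i≮n∸k with any? (λ c → (toℕ c ℕ.<? n ∸ k) ×-dec is-true? (colour (σ ⟨$⟩ʳ c)))
      where
      is-true? : ∀ c → Dec (c ≡ just true)
      is-true? (just true)  = yes refl
      is-true? (just false) = no λ ()
      is-true? nothing      = no λ ()
    ...   | yes (c , c<n∸k , c-true) = c , c<n∸k , c-true , λ j j-false →
              ℕ.<-≤-trans c<n∸k (≤-trans (ℕ.≮⇒≥ i≮n∸k) (ℕ.<⇒≤ (i<false j j-false)))
    ...   | no  ∄c = contradiction (injection-≥⇒≤ places-injective n∸k≤places)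
                       λ le → <-irrefl (sym (ℕ.m∸[m∸n]≡n k≤n)) le
      where
      places : Fin (suc k) → Fin n
      places = b ∷ λ s → σ ⟨$⟩ˡ f s

      coloured-place : ∀ s → colour (σ ⟨$⟩ʳ (σ ⟨$⟩ˡ f s)) ≢ nothing
      coloured-place s eq = f-coloured s (trans (cong colour (sym (inverseʳ σ))) eq)

      places-injective : Injective _≡_ _≡_ places
      places-injective = ∷-injective
        (λ s eq → coloured-place s (trans (cong (colour ∘ (σ ⟨$⟩ʳ_)) eq) b-plain))
        (f-injective ∘ permutation-inverse-injective σ)

      -- Here `i` lies in the clique and every place coloured false comes after it, while `∄c` keeps
      -- the places coloured true off the stick.
      n∸k≤coloured : ∀ j → colour (σ ⟨$⟩ʳ j) ≢ nothing → n ∸ k ≤ toℕ j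
      n∸k≤coloured j j-coloured with colour (σ ⟨$⟩ʳ j) in eq
      ... | nothing    = contradiction refl j-coloured
      ... | just true  = ℕ.≮⇒≥ λ j<n∸k → ∄c (j , j<n∸k , eq)
      ... | just false = ≤-trans (ℕ.≮⇒≥ i≮n∸k) (ℕ.<⇒≤ (i<false j eq))

      n∸k≤places : ∀ s → n ∸ k ≤ toℕ (places s)
      n∸k≤places zero    = n∸k≤b
      n∸k≤places (suc s) = n∸k≤coloured _ (coloured-place s)

    within-clique : n ∸ k ≤ toℕ a × n ∸ k ≤ toℕ b → Precedes σ′
    within-clique (n∸k≤a , n∸k≤b) with true-on-stick n∸k≤b
    ... | c , c<n∸k , c-true , c<false =
      c , trans (sym (unmoved (below n∸k≤a) (below n∸k≤b))) c-true , c<false′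
      where
      below : ∀ {d} → n ∸ k ≤ toℕ d → c ≢ d
      below n∸k≤d refl = <-irrefl refl (ℕ.<-≤-trans c<n∸k n∸k≤d)

      c<false′ : ∀ j → colour (σ′ ⟨$⟩ʳ j) ≡ just false → toℕ c < toℕ j
      c<false′ j j-false with j ≟ b
      ... | yes refl = ℕ.<-≤-trans c<n∸k n∸k≤b
      ... | no j≢b   = c<false j (trans (unmoved (false′⇒≢a j-false) j≢b) j-false)

  -- By `no-edge`, two persons who exchange places have the same colour or one of them is
  -- uncoloured. If that one stands at `a`, the edge is read in the other direction.
  precedes-invariant : ∀ {σ σ′} → FSAdj (Lollipop n k) Y σ σ′ → Precedes σ → Precedes σ′
  precedes-invariant {σ} {σ′} e@(a , b , Xab , Yab , σa≡σ′b , σb≡σ′a , rest)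
    with colour (σ ⟨$⟩ʳ a) in a-colour | colour (σ ⟨$⟩ʳ b) in b-colour
  ... | _          | nothing    = precedes-uncoloured {σ} {σ′} e b-colour
  ... | nothing    | just _     = precedes-uncoloured {σ} {σ′}
    (b , a , adj-sym (Lollipop n k) Xab , adj-sym Y Yab , σb≡σ′a , σa≡σ′b
       , λ c c≢b c≢a → rest c c≢a c≢b) a-colour
  ... | just true  | just true  = precedes-same-colour {σ} {σ′} e (trans a-colour (sym b-colour))
  ... | just false | just false = precedes-same-colour {σ} {σ′} e (trans a-colour (sym b-colour))
  ... | just true  | just false = contradiction b-colour (no-edge _ _ Yab a-colour)
  ... | just false | just true  = contradiction a-colour (no-edge _ _ (adj-sym Y Yab) b-colour)

  precedes-walk : ∀ {σ τ} → Star (FSAdj (Lollipop n k) Y) σ τ → Precedes σ → Precedes τ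
  precedes-walk ε        = id
  precedes-walk {σ} (_◅_ {j = ρ} e es) = precedes-walk es ∘ precedes-invariant {σ} {ρ} e

-- Necessity: the colouring given by an induced disjoint union

-- The copy of `G` is coloured true, that of `H` false, the rest not at all. `Precedes` separates an
-- arrangement with a vertex of `G` at place zero from one with a vertex of `H` there; the orders
-- `suc p` and `suc q` provide these vertices.
union-obstructs-connectivity :
  (Y : GraphOn n) (G : GraphOn (suc p)) (H : GraphOn (suc q)) → suc p + suc q ≤ n →
  HasInduced Y (G ∪ H) → ¬ Connected (FS (Lollipop n (suc p + suc q)) Y)
union-obstructs-connectivity {n = zero}  Y G H () _ _
union-obstructs-connectivity {n = suc n} {p} {q} Y G H k≤n (S , Y[S]≅G∪H) connected
  -- The walk ends at some `ρ` that equals the target only pointwise, so `Precedes` is refuted for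
  -- every such `ρ`.
  = let ρ , walk , ρ≈ = connected (start (inj₁ zero)) (start (inj₂ zero))
    in second-not-first ρ ρ≈ (precedes-walk {start (inj₁ zero)} {ρ} walk first-precedes)
  where
  open _≅_ Y[S]≅G∪H
  open Setoid (⊎-setoid (≡-setoid (suc p)) (≡-setoid (suc q)))
    using (_≈_) renaming (sym to ≈-sym; trans to ≈-trans)

  vertex : Fin (suc p) ⊎ Fin (suc q) → Fin (suc n)
  vertex = proj₁ ∘ from

  side : Fin (suc p) ⊎ Fin (suc q) → Bool
  side = [ (λ _ → true) , (λ _ → false) ]′

  colour : Fin (suc n) → Maybe Bool
  colour x with x ∈? S
  ... | yes x∈S = just (side (to (x , x∈S)))
  ... | no  _   = nothing

  side-cong : ∀ {s t} → s ≈ t → side s ≡ side t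
  side-cong (inj₁ _) = refl
  side-cong (inj₂ _) = refl

  ≈⇒≡ : ∀ {s t} → s ≈ t → s ≡ t
  ≈⇒≡ (inj₁ refl) = refl
  ≈⇒≡ (inj₂ refl) = refl

  -- Vertices of the induced subgraph are compared by first component, so `x` may carry any proof of
  -- membership in `S`.
  to-vertex : ∀ s {x} → proj₁ x ≡ vertex s → to x ≈ s
  to-vertex s = Inverse.inverseˡ bijection

  vertex-injective : Injective _≡_ _≡_ vertex
  vertex-injective {s} {t} eq = ≈⇒≡ (≈-trans (≈-sym (to-vertex s {from s} refl)) (to-vertex t eq))

  colour-vertex : ∀ s → colour (vertex s) ≡ just (side s)
  colour-vertex s with vertex s ∈? S
  ... | yes v∈S = cong just (side-cong (to-vertex s {vertex s , v∈S} refl))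
  ... | no  v∉S = contradiction (proj₂ (from s)) v∉S

  no-cross : ∀ {s t} → Adj (G ∪ H) s t → side s ≡ true → side t ≢ false
  no-cross (inj₁ _) _  ()
  no-cross (inj₂ _) ()

  no-edge : ∀ x y → Adj Y x y → colour x ≡ just true → colour y ≢ just false
  no-edge x y xy x-true y-false with x ∈? S | y ∈? S
  ... | yes x∈S | yes y∈S = no-cross (Equivalence.to (adj⇔adj (x , x∈S) (y , y∈S)) xy)
                              (just-injective x-true) (just-injective y-false)

  coloured : Fin (suc p + suc q) → Fin (suc n)
  coloured = vertex ∘ splitAt (suc p)

  coloured-injective : Injective _≡_ _≡_ coloured
  coloured-injective {i} {j} eq = begin
    i                                         ≡⟨ join-splitAt (suc p) (suc q) i ⟨
    join (suc p) (suc q) (splitAt (suc p) i)  ≡⟨ cong (join (suc p) (suc q)) (vertex-injective eq) ⟩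
    join (suc p) (suc q) (splitAt (suc p) j)  ≡⟨ join-splitAt (suc p) (suc q) j ⟩
    j                                         ∎
    where open ≡-Reasoning

  open Colouring Y k≤n colour no-edge coloured coloured-injective
    (λ i eq → contradiction (trans (sym (colour-vertex (splitAt (suc p) i))) eq) λ ())

  start : Fin (suc p) ⊎ Fin (suc q) → Permutation (suc n) (suc n)
  start s = transpose zero (vertex s)

  start-colour : ∀ s → colour (start s ⟨$⟩ʳ zero) ≡ just (side s)
  start-colour s = trans (cong colour (swap-matchˡ zero (vertex s))) (colour-vertex s)

  first-precedes : Precedes (start (inj₁ zero))
  first-precedes = zero , start-colour (inj₁ zero) , 0<false
    where
    0<false : ∀ j → colour (start (inj₁ zero) ⟨$⟩ʳ j) ≡ just false → 0 < toℕ j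
    0<false zero    j-false = contradiction (trans (sym (start-colour (inj₁ zero))) j-false) λ ()
    0<false (suc j) _       = s≤s z≤n

  second-not-first : ∀ ρ → (∀ i → ρ ⟨$⟩ʳ i ≡ start (inj₂ zero) ⟨$⟩ʳ i) → ¬ Precedes ρ
  second-not-first ρ ρ≈ (i , _ , i<false) = contradiction
    (i<false zero (trans (cong colour (ρ≈ zero)) (start-colour (inj₂ zero)))) λ ()

-- Sufficiency: composing walks of exchanges

-- A set of `k` vertices is given by an injective listing, and the walk runs over indices, so that
-- it cannot leave the set.
LocallyConnected : ℕ → GraphOn n → Set
LocallyConnected {n} k Y =
  ∀ (f : Fin k → Fin n) → Injective _≡_ _≡_ f → ∀ i j → Star (Adj Y on f) i j

record Reachable (X Y : GraphOn n) (σ τ : Permutation n n) : Set where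
  constructor reached
  field
    {end} : Permutation n n
    walk  : Star (FSAdj X Y) σ end
    end≈  : ∀ i → end ⟨$⟩ʳ i ≡ τ ⟨$⟩ʳ i

module _ {X Y : GraphOn n} where

  reachable-≈ : ∀ {σ τ} → (∀ i → σ ⟨$⟩ʳ i ≡ τ ⟨$⟩ʳ i) → Reachable X Y σ τ
  reachable-≈ = reached ε

  reachable-trans : ∀ {σ τ υ} → Reachable X Y σ τ → Reachable X Y τ υ → Reachable X Y σ υ
  reachable-trans (reached σ⟶ρ ρ≈τ) (reached ε τ≈υ) = reached σ⟶ρ λ i → trans (ρ≈τ i) (τ≈υ i)
  -- The second walk starts at `τ`, which equals `ρ` only pointwise; it suffices to move the start
  -- of its first step to `ρ`.
  reachable-trans {τ = τ} (reached {ρ} σ⟶ρ ρ≈τ) (reached (_◅_ {j = τ′} e es) π≈υ) =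
    reached (σ⟶ρ ◅◅ (proj₂ (adj-resp (FS X Y)) {τ′} {τ} {ρ} (λ i → sym (ρ≈τ i)) e ◅ es)) π≈υ

  fs-adj-transpose : ∀ σ {a b u v} → σ ⟨$⟩ʳ a ≡ u → σ ⟨$⟩ʳ b ≡ v → Adj X a b → Adj Y u v →
                     Reachable X Y σ (σ ∘ₚ transpose u v)
  fs-adj-transpose σ {a} {b} refl refl ab uv = reached {end = σ ∘ₚ transpose _ _} (e ◅ ε) λ _ → refl
    where
    e : FSAdj X Y σ (σ ∘ₚ transpose (σ ⟨$⟩ʳ a) (σ ⟨$⟩ʳ b))
    e = a , b , ab , uv
      , sym (swap-matchʳ (σ ⟨$⟩ʳ a) (σ ⟨$⟩ʳ b)) , sym (swap-matchˡ (σ ⟨$⟩ʳ a) (σ ⟨$⟩ʳ b))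
      , λ c c≢a c≢b → sym (swap-mismatch (c≢a ∘ permutation-injective σ)
                                         (c≢b ∘ permutation-injective σ))

-- Sufficiency: settling the places one by one

Agree : ℕ → Rel (Permutation n n) 0ℓ
Agree m σ τ = ∀ i → toℕ i < m → σ ⟨$⟩ʳ i ≡ τ ⟨$⟩ʳ i

-- Refers to the target `τ`, which stays fixed while the current arrangement changes.
Remaining : Permutation n n → ℕ → Fin n → Set
Remaining τ m x = ∀ i → toℕ i < m → τ ⟨$⟩ʳ i ≢ x

remaining-at : ∀ (σ τ : Permutation n n) {j} → Agree m σ τ → m ≤ toℕ j → Remaining τ m (σ ⟨$⟩ʳ j)
remaining-at σ τ agree m≤j i i<m τi≡σj
  with refl ← permutation-injective σ (trans (agree i i<m) τi≡σj) = <-irrefl refl (ℕ.<-≤-trans i<m m≤j)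

place-remaining : ∀ (σ τ : Permutation n n) {x} → Agree m σ τ → Remaining τ m x → m ≤ toℕ (σ ⟨$⟩ˡ x)
place-remaining σ τ agree x-rem =
  ℕ.≮⇒≥ λ place<m → x-rem _ place<m (trans (sym (agree _ place<m)) (inverseʳ σ))

agree-transpose : ∀ (σ τ : Permutation n n) {u v} → Agree m σ τ →
                  Remaining τ m u → Remaining τ m v → Agree m (σ ∘ₚ transpose u v) τ
agree-transpose σ τ agree u-rem v-rem i i<m = trans
  (swap-mismatch (u-rem i i<m ∘ trans (sym (agree i i<m))) (v-rem i i<m ∘ trans (sym (agree i i<m))))
  (agree i i<m)

agree-suc : ∀ (σ τ : Permutation n n) {i} → toℕ i ≡ m → σ ⟨$⟩ʳ i ≡ τ ⟨$⟩ʳ i →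
            Agree m σ τ → Agree (suc m) σ τ
agree-suc σ τ {i} refl eq agree l (s≤s l≤i) with l ≟ i
... | yes refl = eq
... | no l≢i   = agree l (ℕ.≤∧≢⇒< l≤i (l≢i ∘ toℕ-injective))

module Sorting (Y : GraphOn n) (k≤n : suc (suc k) ≤ n) (locally : LocallyConnected (suc (suc k)) Y) where

  private
    stick : ℕ
    stick = n ∸ suc (suc k)

    X : GraphOn n
    X = Lollipop n (suc (suc k))

  RemainingWalk : Permutation n n → ℕ → Rel (Fin n) 0ℓ
  RemainingWalk τ m = Star (λ x y → Adj Y x y × Remaining τ m y)

  -- As `m ≤ stick`, the persons on the last `suc (suc k)` places of `τ` all remain. Two of them,
  -- including `u` and `w` if present, are dropped and `u` and `w` put at the head; local
  -- connectivity of this list joins indices `0F` and `1F`.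
  remaining-connected : ∀ τ {u w} → m ≤ stick → Remaining τ m u → Remaining τ m w → RemainingWalk τ m u w
  remaining-connected {m} τ {u} {w} m≤stick u-rem w-rem with u ≟ w
  ... | yes refl = ε
  ... | no  u≢w  = gmap f (λ {_} {j} e → e , f-rem j) (locally f f-injective 0F 1F)
    where
    last : Fin (suc (suc k)) → Fin n
    -- Reversal by `opposite` turns the first `suc (suc k)` places into the last ones.
    last i = τ ⟨$⟩ʳ opposite (inject≤ i k≤n)

    last-injective : Injective _≡_ _≡_ last
    last-injective {i} {j} eq = inject≤-injective k≤n k≤n i j (begin
      inject≤ i k≤n                        ≡⟨ opposite-involutive _ ⟨
      opposite (opposite (inject≤ i k≤n))  ≡⟨ cong opposite (permutation-injective τ eq) ⟩
      opposite (opposite (inject≤ j k≤n))  ≡⟨ opposite-involutive _ ⟩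
      inject≤ j k≤n                        ∎)
      where open ≡-Reasoning

    last-rem : ∀ i → Remaining τ m (last i)
    last-rem i = remaining-at τ τ (λ _ _ → refl) (≤-trans m≤stick (begin
      stick                             ≤⟨ ℕ.∸-monoʳ-≤ n (toℕ<n i) ⟩
      n ∸ suc (toℕ i)                   ≡⟨ cong (λ l → n ∸ suc l) (toℕ-inject≤ i k≤n) ⟨
      n ∸ suc (toℕ (inject≤ i k≤n))     ≡⟨ opposite-prop (inject≤ i k≤n) ⟨
      toℕ (opposite (inject≤ i k≤n))    ∎))
      where open ℕ.≤-Reasoning

    avoid-u = punchIn-avoiding last-injective u
    a = proj₁ avoid-u

    last-a-injective : Injective _≡_ _≡_ (last ∘ punchIn a)
    last-a-injective = punchIn-injective a _ _ ∘ last-injective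

    avoid-w = punchIn-avoiding last-a-injective w
    b = proj₁ avoid-w

    f : Fin (suc (suc k)) → Fin n
    f = u ∷ w ∷ last ∘ punchIn a ∘ punchIn b

    f-injective : Injective _≡_ _≡_ f
    f-injective = ∷-injective
      (λ { zero → ≢-sym u≢w ; (suc i) → proj₂ avoid-u (punchIn b i) })
      (∷-injective (proj₂ avoid-w) (punchIn-injective b _ _ ∘ last-a-injective))

    f-rem : ∀ i → Remaining τ m (f i)
    f-rem zero          = u-rem
    f-rem (suc zero)    = w-rem
    f-rem (suc (suc i)) = last-rem (punchIn a (punchIn b i))

  -- Once the stick is settled, all remaining persons stand in the clique, where any two places are
  -- adjacent.
  adjacent-transposable : ∀ σ τ {u v} → Agree stick σ τ → Remaining τ stick u → Remaining τ stick v →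
                          Adj Y u v → Reachable X Y σ (σ ∘ₚ transpose u v)
  adjacent-transposable σ τ agree u-rem v-rem uv =
    fs-adj-transpose σ (inverseʳ σ) (inverseʳ σ)
      (lollipop-clique {k = suc (suc k)}
        (place-remaining σ τ agree u-rem) (place-remaining σ τ agree v-rem)
        λ eq → adj-irrefl Y (permutation-inverse-injective σ eq) uv)
      uv

  -- Induction on the walk by `swap-conjugate`, which needs three distinct persons; hence the
  -- separate cases `u ≡ w` and `v ≡ w`. The arrangement `σ` is general because the hypothesis is
  -- applied to `σ₁`.
  walk-transposable : ∀ τ {u w} → Remaining τ stick u → RemainingWalk τ stick u w →
                      ∀ σ → Agree stick σ τ → Reachable X Y σ (σ ∘ₚ transpose u w)
  walk-transposable τ {u} u-rem ε σ agree = reachable-≈ λ i → sym (swap-self u (σ ⟨$⟩ʳ i))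
  walk-transposable τ {u} {w} u-rem (_◅_ {j = v} (uv , v-rem) walk) σ agree with u ≟ w | v ≟ w
  ... | yes refl | _        = reachable-≈ λ i → sym (swap-self u (σ ⟨$⟩ʳ i))
  ... | no _     | yes refl = adjacent-transposable σ τ agree u-rem v-rem uv
  ... | no u≢w   | no v≢w   =
    reachable-trans (adjacent-transposable σ τ agree u-rem v-rem uv)
    (reachable-trans (walk-transposable τ v-rem walk σ₁ agree₁)
    (reachable-trans (adjacent-transposable σ₂ τ agree₂ u-rem v-rem uv)
    (reachable-≈ λ i → swap-conjugate u≢v u≢w v≢w (σ ⟨$⟩ʳ i))))
    where
    u≢v : u ≢ v
    u≢v u≡v = adj-irrefl Y u≡v uv

    σ₁ = σ ∘ₚ transpose u v
    σ₂ = σ₁ ∘ₚ transpose v w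

    walk-end : ∀ {x y} → Remaining τ stick x → RemainingWalk τ stick x y → Remaining τ stick y
    walk-end x-rem ε                    = x-rem
    walk-end x-rem ((_ , y-rem) ◅ rest) = walk-end y-rem rest

    agree₁ : Agree stick σ₁ τ
    agree₁ = agree-transpose σ τ agree u-rem v-rem

    agree₂ : Agree stick σ₂ τ
    agree₂ = agree-transpose σ₁ τ agree₁ v-rem (walk-end v-rem walk)

  -- Each person on the walk is first brought to place suc m and then
  -- exchanged with its predecessor at place m.
  walk-reaches-place : ∀ {i i⁺ : Fin n} τ → toℕ i ≡ m → toℕ i⁺ ≡ suc m → m < stick →
    (∀ σ ρ → Agree (suc m) σ ρ → Reachable X Y σ ρ) →
    ∀ {u w} → RemainingWalk τ m u w → ∀ σ → Agree m σ τ → σ ⟨$⟩ʳ i ≡ u →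
    ∃[ ρ ] Reachable X Y σ ρ × Agree m ρ τ × ρ ⟨$⟩ʳ i ≡ w
  walk-reaches-place τ _ _ _ _ ε σ agree σi≡u = σ , reachable-≈ (λ _ → refl) , agree , σi≡u
  walk-reaches-place {i = i} {i⁺} τ refl i⁺≡1+i i<stick sort (_◅_ {j = v} (uv , v-rem) walk) σ agree refl =
    let ρ , σ₂⟶ρ , agree-ρ , ρi≡w = walk-reaches-place τ refl i⁺≡1+i i<stick sort walk σ₂ agree₂ σ₂i≡v
    in ρ
     , reachable-trans (sort σ σ₁ agree₁)
         (reachable-trans (fs-adj-transpose σ₁ σ₁i≡u σ₁i⁺≡v (inj₁ (inj₁ (sym i⁺≡1+i , i<stick))) uv) σ₂⟶ρ)
     , agree-ρ , ρi≡w
    where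
    u = σ ⟨$⟩ʳ i
    x = σ ⟨$⟩ʳ i⁺
    -- Bringing `v` to `i⁺` at the expense of `x` moves nobody on the first `suc m` places, so
    -- `sort` reaches `σ₁`.
    σ₁ = σ ∘ₚ transpose x v
    σ₂ = σ₁ ∘ₚ transpose u v

    u-rem : Remaining τ (toℕ i) u
    u-rem = remaining-at σ τ agree ≤-refl

    x-rem : Remaining τ (toℕ i) x
    x-rem = remaining-at σ τ agree (≤-trans (ℕ.n≤1+n _) (≤-reflexive (sym i⁺≡1+i)))

    σ₁i≡u : σ₁ ⟨$⟩ʳ i ≡ u
    σ₁i≡u = swap-mismatch
      (λ eq → ℕ.1+n≢n (trans (sym i⁺≡1+i) (cong toℕ (sym (permutation-injective σ eq)))))
      (λ u≡v → adj-irrefl Y u≡v uv)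

    σ₁i⁺≡v : σ₁ ⟨$⟩ʳ i⁺ ≡ v
    σ₁i⁺≡v = swap-matchˡ x v

    agree₁ : Agree (suc (toℕ i)) σ σ₁
    agree₁ = agree-suc σ σ₁ refl (sym σ₁i≡u) λ l l<i →
      trans (agree l l<i) (sym (agree-transpose σ τ agree x-rem v-rem l l<i))

    agree₂ : Agree (toℕ i) σ₂ τ
    agree₂ = agree-transpose σ₁ τ (agree-transpose σ τ agree x-rem v-rem) u-rem v-rem

    σ₂i≡v : σ₂ ⟨$⟩ʳ i ≡ v
    σ₂i≡v = trans (cong (swap u v) σ₁i≡u) (swap-matchˡ u v)

  -- Induction on the number `d` of unsettled places. The hypothesis for `suc m` also serves as the
  -- `sort` of `walk-reaches-place`.
  agree⇒reachable : ∀ d → m + d ≡ n → ∀ σ τ → Agree m σ τ → Reachable X Y σ τ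
  agree⇒reachable {m} zero m+0≡n σ τ agree =
    reachable-≈ λ i → agree i (subst (toℕ i <_) (trans (sym m+0≡n) (ℕ.+-identityʳ m)) (toℕ<n i))
  agree⇒reachable {m} (suc d) m+1+d≡n σ τ agree = by-place (stick ℕ.≤? m)
    where
    1+m+d≡n : suc m + d ≡ n
    1+m+d≡n = trans (sym (ℕ.+-suc m d)) m+1+d≡n

    m<n : m < n
    m<n = subst (m <_) 1+m+d≡n (s≤s (ℕ.m≤m+n m d))

    i : Fin n
    i = fromℕ< m<n

    i≡m : toℕ i ≡ m
    i≡m = toℕ-fromℕ< m<n

    by-place : Dec (stick ≤ m) → Reachable X Y σ τ
    by-place (yes stick≤m) = reachable-trans
      -- Past the stick, the persons not yet settled may be too few to induce a connected subgraph.
      -- The walk therefore uses everyone in the clique; its net effect is one transposition, which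
      -- leaves the settled persons in place.
      (walk-transposable τ σi-rem (remaining-connected τ ≤-refl σi-rem τi-rem) σ agree-stick)
      (agree⇒reachable d 1+m+d≡n (σ ∘ₚ transpose (σ ⟨$⟩ʳ i) (τ ⟨$⟩ʳ i)) τ
        (agree-suc (σ ∘ₚ transpose (σ ⟨$⟩ʳ i) (τ ⟨$⟩ʳ i)) τ i≡m (swap-matchˡ (σ ⟨$⟩ʳ i) (τ ⟨$⟩ʳ i))
          (agree-transpose σ τ agree (remaining-at σ τ agree m≤i) (remaining-at τ τ (λ _ _ → refl) m≤i))))
      where
      m≤i : m ≤ toℕ i
      m≤i = ≤-reflexive (sym i≡m)

      agree-stick : Agree stick σ τ
      agree-stick l l<stick = agree l (ℕ.<-≤-trans l<stick stick≤m)

      σi-rem = remaining-at σ τ agree-stick (≤-trans stick≤m m≤i)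
      τi-rem = remaining-at τ τ (λ _ _ → refl) (≤-trans stick≤m m≤i)
    by-place (no stick≰m) =
      let ρ , σ⟶ρ , agree-ρ , ρi≡τi = walk-reaches-place τ i≡m (toℕ-fromℕ< 1+m<n) m<stick
            (agree⇒reachable d 1+m+d≡n) walk σ agree refl
      in reachable-trans σ⟶ρ (agree⇒reachable d 1+m+d≡n ρ τ (agree-suc ρ τ i≡m ρi≡τi agree-ρ))
      where
      m<stick : m < stick
      m<stick = ℕ.≰⇒> stick≰m

      m≤i : m ≤ toℕ i
      m≤i = ≤-reflexive (sym i≡m)

      1+m<n : suc m < n
      1+m<n = ℕ.≤-<-trans m<stick (ℕ.∸-monoʳ-< (s≤s z≤n) k≤n)

      walk : RemainingWalk τ m (σ ⟨$⟩ʳ i) (τ ⟨$⟩ʳ i)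
      walk = remaining-connected τ (ℕ.<⇒≤ m<stick)
        (remaining-at σ τ agree m≤i) (remaining-at τ τ (λ _ _ → refl) m≤i)

  connected : Connected (FS X Y)
  connected σ τ with agree⇒reachable n refl σ τ (λ _ ())
  ... | reached walk end≈ = _ , walk , end≈

-- Induced copies from embeddings

does≡true⇒ : {A : Set} (a? : Dec A) → does a? ≡ true → A
does≡true⇒ (yes a) _ = a

-- The vertex set is the image of `f`, decided by a search in each summand; by injectivity the
-- preimage found is an inverse.
embedding⇒induced :
  (Y : GraphOn n) {G : GraphOn p} {H : GraphOn q} (f : Fin p ⊎ Fin q → Fin n) →
  Injective _≡_ _≡_ f → (∀ s t → Adj Y (f s) (f t) ⇔ Adj (G ∪ H) s t) → HasInduced Y (G ∪ H)
embedding⇒induced {n} {p} {q} Y {G} {H} f f-injective adj⇔ = S , record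
  { bijection = record
    { to        = λ x → proj₁ (preimage x)
    ; from      = λ s → f s , image s
    ; to-cong   = λ {x} {y} x≡y → ≡⇒≈ (f-injective
                    (trans (proj₂ (preimage x)) (trans x≡y (sym (proj₂ (preimage y))))))
    ; from-cong = f-cong
    ; inverse   = (λ {s} {x} x≡fs → ≡⇒≈ (f-injective (trans (proj₂ (preimage x)) x≡fs)))
                , (λ {x} s≈ → trans (f-cong s≈) (proj₂ (preimage x)))
    }
  ; adj⇔adj = λ u v → let s , fs≡u = preimage u ; t , ft≡v = preimage v
                    in subst₂ (λ x y → Adj Y x y ⇔ Adj (G ∪ H) s t) fs≡u ft≡v (adj⇔ s t)
  }
  where
  open Setoid (⊎-setoid (≡-setoid p) (≡-setoid q)) using (_≈_) renaming (reflexive to ≡⇒≈)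

  f-cong : ∀ {s t} → s ≈ t → f s ≡ f t
  f-cong (inj₁ refl) = refl
  f-cong (inj₂ refl) = refl

  preimage? : ∀ x → Dec ((∃[ i ] f (inj₁ i) ≡ x) ⊎ (∃[ j ] f (inj₂ j) ≡ x))
  preimage? x = any? (λ i → f (inj₁ i) ≟ x) ⊎-dec any? (λ j → f (inj₂ j) ≟ x)

  S : Subset n
  S = Vec.tabulate (λ x → does (preimage? x))

  lookup-S : ∀ x → Vec.lookup S x ≡ does (preimage? x)
  lookup-S = lookup∘tabulate (λ x → does (preimage? x))

  preimage : ((x , _) : ∃[ x ] x ∈ S) → ∃[ s ] f s ≡ x
  preimage (x , x∈S) with does≡true⇒ (preimage? x) (trans (sym (lookup-S x)) ([]=⇒lookup x∈S))
  ... | inj₁ (i , eq) = inj₁ i , eq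
  ... | inj₂ (j , eq) = inj₂ j , eq

  image : ∀ s → f s ∈ S
  image s = lookup⇒[]= (f s) S (trans (lookup-S (f s)) (dec-true (preimage? (f s)) (split s)))
    where
    split : ∀ s → (∃[ i ] f (inj₁ i) ≡ f s) ⊎ (∃[ j ] f (inj₂ j) ≡ f s)
    split (inj₁ i) = inj₁ (i , refl)
    split (inj₂ j) = inj₂ (j , refl)

separate-embeddings⇒induced :
  (Y : GraphOn n) {G : GraphOn p} {H : GraphOn q} (g : Fin p → Fin n) (h : Fin q → Fin n) →
  Injective _≡_ _≡_ g → Injective _≡_ _≡_ h → (∀ i j → g i ≢ h j) →
  (∀ i j → Adj Y (g i) (g j) ⇔ Adj G i j) → (∀ i j → Adj Y (h i) (h j) ⇔ Adj H i j) →
  (∀ i j → ¬ Adj Y (g i) (h j)) → HasInduced Y (G ∪ H)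
separate-embeddings⇒induced Y {G} {H} g h g-inj h-inj g≢h g-adj h-adj no-cross =
  embedding⇒induced Y {G} {H} [ g , h ]′ injective λ where
    (inj₁ i) (inj₁ j) → mk⇔ (inj₁ ∘ Equivalence.to (g-adj i j)) λ { (inj₁ e) → Equivalence.from (g-adj i j) e }
    (inj₂ i) (inj₂ j) → mk⇔ (inj₂ ∘ Equivalence.to (h-adj i j)) λ { (inj₂ e) → Equivalence.from (h-adj i j) e }
    (inj₁ i) (inj₂ j) → mk⇔ (λ e → contradiction e (no-cross i j)) λ ()
    (inj₂ i) (inj₁ j) → mk⇔ (λ e → contradiction (adj-sym Y e) (no-cross j i)) λ ()
  where
  injective : Injective _≡_ _≡_ [ g , h ]′
  injective {inj₁ i} {inj₁ j} eq = cong inj₁ (g-inj eq)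
  injective {inj₁ i} {inj₂ j} eq = contradiction eq (g≢h i j)
  injective {inj₂ i} {inj₁ j} eq = contradiction (sym eq) (g≢h j i)
  injective {inj₂ i} {inj₂ j} eq = cong inj₂ (h-inj eq)

-- Connectivity of five-vertex subgraphs

module _ (Y : GraphOn n) where

  edge-injective : (h : Fin 2 → Fin n) → Adj Y (h 0F) (h 1F) → Injective _≡_ _≡_ h
  edge-injective h h₀₁ {0F} {0F} _  = refl
  edge-injective h h₀₁ {0F} {1F} eq = contradiction h₀₁ (adj-irrefl Y eq)
  edge-injective h h₀₁ {1F} {0F} eq = contradiction h₀₁ (adj-irrefl Y (sym eq))
  edge-injective h h₀₁ {1F} {1F} _  = refl

  edge-path₂ : (h : Fin 2 → Fin n) → Adj Y (h 0F) (h 1F) →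
               ∀ i j → Adj Y (h i) (h j) ⇔ Adj (Path 2) i j
  edge-path₂ h h₀₁ 0F 0F = mk⇔ (λ e → contradiction e (adj-irrefl Y refl)) λ { (inj₁ ()) ; (inj₂ ()) }
  edge-path₂ h h₀₁ 0F 1F = mk⇔ (λ _ → inj₁ refl) λ _ → h₀₁
  edge-path₂ h h₀₁ 1F 0F = mk⇔ (λ _ → inj₂ refl) λ _ → adj-sym Y h₀₁
  edge-path₂ h h₀₁ 1F 1F = mk⇔ (λ e → contradiction e (adj-irrefl Y refl)) λ { (inj₁ ()) ; (inj₂ ()) }

  module _ (g : Fin 3 → Fin n) (g₀₁ : Adj Y (g 0F) (g 1F)) (g₁₂ : Adj Y (g 1F) (g 2F)) where

    path-injective : g 0F ≢ g 2F → Injective _≡_ _≡_ g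
    path-injective g₀≢g₂ {0F} {0F} _  = refl
    path-injective g₀≢g₂ {0F} {1F} eq = contradiction g₀₁ (adj-irrefl Y eq)
    path-injective g₀≢g₂ {0F} {2F} eq = contradiction eq g₀≢g₂
    path-injective g₀≢g₂ {1F} {0F} eq = contradiction g₀₁ (adj-irrefl Y (sym eq))
    path-injective g₀≢g₂ {1F} {1F} _  = refl
    path-injective g₀≢g₂ {1F} {2F} eq = contradiction g₁₂ (adj-irrefl Y eq)
    path-injective g₀≢g₂ {2F} {0F} eq = contradiction (sym eq) g₀≢g₂
    path-injective g₀≢g₂ {2F} {1F} eq = contradiction g₁₂ (adj-irrefl Y (sym eq))
    path-injective g₀≢g₂ {2F} {2F} _  = refl

    path-path₃ : ¬ Adj Y (g 0F) (g 2F) → ∀ i j → Adj Y (g i) (g j) ⇔ Adj (Path 3) i j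
    path-path₃ ¬g₀₂ 0F 0F = mk⇔ (λ e → contradiction e (adj-irrefl Y refl)) λ { (inj₁ ()) ; (inj₂ ()) }
    path-path₃ ¬g₀₂ 0F 1F = mk⇔ (λ _ → inj₁ refl) λ _ → g₀₁
    path-path₃ ¬g₀₂ 0F 2F = mk⇔ (λ e → contradiction e ¬g₀₂) λ { (inj₁ ()) ; (inj₂ ()) }
    path-path₃ ¬g₀₂ 1F 0F = mk⇔ (λ _ → inj₂ refl) λ _ → adj-sym Y g₀₁
    path-path₃ ¬g₀₂ 1F 1F = mk⇔ (λ e → contradiction e (adj-irrefl Y refl)) λ { (inj₁ ()) ; (inj₂ ()) }
    path-path₃ ¬g₀₂ 1F 2F = mk⇔ (λ _ → inj₁ refl) λ _ → g₁₂
    path-path₃ ¬g₀₂ 2F 0F = mk⇔ (λ e → contradiction (adj-sym Y e) ¬g₀₂) λ { (inj₁ ()) ; (inj₂ ()) }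
    path-path₃ ¬g₀₂ 2F 1F = mk⇔ (λ _ → inj₂ refl) λ _ → adj-sym Y g₁₂
    path-path₃ ¬g₀₂ 2F 2F = mk⇔ (λ e → contradiction e (adj-irrefl Y refl)) λ { (inj₁ ()) ; (inj₂ ()) }

    triangle-complete₃ : Adj Y (g 0F) (g 2F) → ∀ i j → Adj Y (g i) (g j) ⇔ Adj (Complete 3) i j
    triangle-complete₃ g₀₂ i j =
      mk⇔ (λ e i≡j → adj-irrefl Y (cong g i≡j) e) (adjacent i j)
      where
      adjacent : ∀ i j → i ≢ j → Adj Y (g i) (g j)
      adjacent 0F 0F i≢j = contradiction refl i≢j
      adjacent 0F 1F _   = g₀₁
      adjacent 0F 2F _   = g₀₂
      adjacent 1F 0F _   = adj-sym Y g₀₁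
      adjacent 1F 1F i≢j = contradiction refl i≢j
      adjacent 1F 2F _   = g₁₂
      adjacent 2F 0F _   = adj-sym Y g₀₂
      adjacent 2F 1F _   = adj-sym Y g₁₂
      adjacent 2F 2F i≢j = contradiction refl i≢j

  -- Without a cross edge, `g` and `h` give a forbidden induced subgraph: a triangle or a path
  -- beside an edge, according to whether the ends of `g` are adjacent.
  has-cross-edge :
    ¬ (HasInduced Y (Complete 3 ∪ Path 2) ⊎ HasInduced Y (Path 3 ∪ Path 2)) →
    (g : Fin 3 → Fin n) (h : Fin 2 → Fin n) →
    Adj Y (g 0F) (g 1F) → Adj Y (g 1F) (g 2F) → g 0F ≢ g 2F → Adj Y (h 0F) (h 1F) →
    ∃[ i ] ∃[ j ] Adj Y (g i) (h j)
  has-cross-edge free g h g₀₁ g₁₂ g₀≢g₂ h₀₁ with any? (λ i → any? λ j → adj? Y (g i) (h j))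
  ... | yes cross = cross
  ... | no ∄cross = contradiction induced-copy free
    where
    no-cross : ∀ i j → ¬ Adj Y (g i) (h j)
    no-cross i j e = ∄cross (i , j , e)

    -- A common vertex would have the other end of the edge `h` as a neighbour, which is a cross
    -- edge.
    g≢h : ∀ i j → g i ≢ h j
    g≢h i 0F eq = no-cross i 1F (subst (λ x → Adj Y x (h 1F)) (sym eq) h₀₁)
    g≢h i 1F eq = no-cross i 0F (subst (λ x → Adj Y x (h 0F)) (sym eq) (adj-sym Y h₀₁))

    g-inj = path-injective g g₀₁ g₁₂ g₀≢g₂
    h-inj = edge-injective h h₀₁
    h-path = edge-path₂ h h₀₁

    induced-copy : HasInduced Y (Complete 3 ∪ Path 2) ⊎ HasInduced Y (Path 3 ∪ Path 2)
    induced-copy with adj? Y (g 0F) (g 2F)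
    ... | yes g₀₂ = inj₁ (separate-embeddings⇒induced Y {Complete 3} {Path 2} g h g-inj h-inj g≢h
                            (triangle-complete₃ g g₀₁ g₁₂ g₀₂) h-path no-cross)
    ... | no ¬g₀₂ = inj₂ (separate-embeddings⇒induced Y {Path 3} {Path 2} g h g-inj h-inj g≢h
                            (path-path₃ g g₀₁ g₁₂ ¬g₀₂) h-path no-cross)

  -- At most `n ∸ (n ∸ k)`, that is `k`, vertices are not adjacent to `v`, counting `v` itself;
  -- `suc k` distinct vertices cannot all be among them.
  has-neighbour : ∀ {v} → k ≤ n → n ∸ k ≤ degree Y v → (f : Fin (suc k) → Fin n) →
                  Injective _≡_ _≡_ f → ∃[ j ] Adj Y v (f j)
  has-neighbour {k} {v} k≤n n∸k≤deg f f-inj with any? (λ j → adj? Y v (f j))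
  ... | yes neighbour = neighbour
  ... | no  ∄neighbour = contradiction (begin
    suc k               ≤⟨ injection-∈⇒≤ f-inj (∁ N) (λ j → x∉p⇒x∈∁p (f∉N j)) ⟩
    ∣ ∁ N ∣             ≡⟨ ∣∁p∣≡n∸∣p∣ N ⟩
    n ∸ degree Y v      ≤⟨ ℕ.∸-monoʳ-≤ n n∸k≤deg ⟩
    n ∸ (n ∸ k)         ≡⟨ ℕ.m∸[m∸n]≡n k≤n ⟩
    k                   ∎) ℕ.1+n≰n
    where
    open ℕ.≤-Reasoning

    N : Subset n
    N = Vec.tabulate (λ w → does (adj? Y v w))

    f∉N : ∀ j → ¬ f j ∈ N
    f∉N j fj∈N = contradiction
      (trans (sym ([]=⇒lookup fj∈N))
        (trans (lookup∘tabulate (λ w → does (adj? Y v w)) (f j))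
               (dec-false (adj? Y v (f j)) (λ e → ∄neighbour (j , e)))))
      λ ()

-- Otherwise a choice of preimages would be an injection from `Fin q` to `Fin p`.
<⇒∃-not-in-image : p < q → (f : Fin p → Fin q) → ∃[ z ] (∀ i → f i ≢ z)
<⇒∃-not-in-image p<q f with any? (λ z → all? λ i → ¬? (f i ≟ z))
... | yes missed = missed
... | no ∄missed = contradiction (injective⇒≤ section-injective) (ℕ.<⇒≱ p<q)
  where
  preimage : ∀ z → ∃[ i ] f i ≡ z
  preimage z with any? (λ i → f i ≟ z)
  ... | yes found  = found
  ... | no  ∄found = contradiction (z , λ i eq → ∄found (i , eq)) ∄missed

  section-injective : Injective _≡_ _≡_ (proj₁ ∘ preimage)
  section-injective {y} {z} eq =
    trans (sym (proj₂ (preimage y))) (trans (cong f eq) (proj₂ (preimage z)))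

injective⇒surjective : {f : Fin n → Fin n} → Injective _≡_ _≡_ f → ∀ z → ∃[ i ] f i ≡ z
injective⇒surjective {f = f} f-inj z with any? (λ i → f i ≟ z)
... | yes found  = found
... | no  ∄found = contradiction
  (injective⇒≤ (∷-injective {x = z} (λ i eq → ∄found (i , eq)) f-inj)) ℕ.1+n≰n

-- Each of the five has a neighbour among them. Given `u ~ x` and `w ~ y` on four distinct vertices,
-- the fifth vertex `z` is adjacent to one of these, which extends one edge to a three-vertex path;
-- `has-cross-edge` joins it to the other edge.
five-connected : (Y : GraphOn n) → 5 ≤ n → (∀ v → n ∸ 4 ≤ degree Y v) →
  ¬ (HasInduced Y (Complete 3 ∪ Path 2) ⊎ HasInduced Y (Path 3 ∪ Path 2)) →
  LocallyConnected 5 Y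
five-connected Y 5≤n deg free f f-inj u w = connect (neighbour u) (neighbour w)
  where
  _~_ : Rel (Fin 5) 0ℓ
  _~_ = Adj Y on f

  neighbour : ∀ i → ∃[ j ] i ~ j
  neighbour i = has-neighbour Y (≤-trans (ℕ.n≤1+n 4) 5≤n) (deg (f i)) f f-inj

  ~⇒≢ : ∀ {i j} → i ~ j → i ≢ j
  ~⇒≢ i~j refl = adj-irrefl Y refl i~j

  ~-sym : ∀ {i j} → i ~ j → j ~ i
  ~-sym = adj-sym Y

  across : ∀ {c d e a b} → c ~ d → d ~ e → c ≢ e → a ~ b → Star _~_ c a
  across {c} {d} {e} {a} {b} c~d d~e c≢e a~b
    with has-cross-edge Y free (f ∘ path) (f ∘ edge) c~d d~e (c≢e ∘ f-inj) a~b
    where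
    path : Fin 3 → Fin 5
    path = c ∷ d ∷ e ∷ []
    edge : Fin 2 → Fin 5
    edge = a ∷ b ∷ []
  ... | i , j , cross = to-path i ◅◅ cross ◅ from-edge j
    where
    to-path : ∀ i → Star _~_ c ((c ∷ d ∷ e ∷ []) i)
    to-path 0F = ε
    to-path 1F = c~d ◅ ε
    to-path 2F = c~d ◅ d~e ◅ ε

    from-edge : ∀ j → Star _~_ ((a ∷ b ∷ []) j) a
    from-edge 0F = ε
    from-edge 1F = ~-sym a~b ◅ ε

  connect : ∃[ x ] u ~ x → ∃[ y ] w ~ y → Star _~_ u w
  connect (x , u~x) (y , w~y) with u ≟ w | x ≟ w | y ≟ u | x ≟ y
  ... | yes refl | _ | _ | _ = ε
  ... | no _ | yes refl | _ | _ = u~x ◅ ε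
  ... | no _ | no _ | yes refl | _ = ~-sym w~y ◅ ε
  ... | no _ | no _ | no _ | yes refl = u~x ◅ ~-sym w~y ◅ ε
  ... | no u≢w | no x≢w | no y≢u | no x≢y
    with <⇒∃-not-in-image ≤-refl (u ∷ w ∷ x ∷ y ∷ [])
  ...   | z , ≢z with neighbour z
  ...     | t , z~t with injective⇒surjective all-distinct t
    where
    all-distinct : Injective _≡_ _≡_ (z ∷ u ∷ w ∷ x ∷ y ∷ [])
    all-distinct =
      ∷-injective ≢z
      (∷-injective (λ { 0F → ≢-sym u≢w ; 1F → ≢-sym (~⇒≢ u~x) ; 2F → y≢u })
      (∷-injective (λ { 0F → x≢w ; 1F → ≢-sym (~⇒≢ w~y) })
      (∷-injective (λ { 0F → ≢-sym x≢y })
      λ { {0F} {0F} _ → refl })))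
  ...       | 0F , refl = contradiction refl (~⇒≢ z~t)
  -- If `z` is attached to `u` or `w`, the path starts at `z`, so a step to `z` comes first. If it
  -- extends the edge at `w`, the walk leads from `w` to `u` and is reversed.
  ...       | 1F , refl = ~-sym z~t ◅ across z~t u~x (≢-sym (≢z 2F)) w~y
  ...       | 2F , refl = reverse ~-sym (~-sym z~t ◅ across z~t w~y (≢-sym (≢z 3F)) u~x)
  ...       | 3F , refl = across u~x (~-sym z~t) (≢z 0F) w~y
  ...       | 4F , refl = reverse ~-sym (across w~y (~-sym z~t) (≢z 1F) u~x)

-- From the minimum degree to the equivalence

δ≤degree : (Y : GraphOn n) → ∀ v → δ Y ≤ degree Y v
δ≤degree {n} Y = tabulate⁻ (min≤xs n (List.tabulate (degree Y)))

corollary1p7 : (n : ℕ) → 5 ≤ n → (Y : GraphOn n) → δ Y ≡ n ∸ 4 →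
    Connected (FS (Lollipop n 5) Y) ⇔
    (¬ (HasInduced Y (Complete 3 ∪ Path 2) ⊎ HasInduced Y (Path 3 ∪ Path 2)))
corollary1p7 n 5≤n Y δ≡n∸4 = mk⇔
  -- Both forbidden graphs have 3 + 2 vertices, the order 5 of the clique.
  (λ connected → [ (λ Y⊇ → union-obstructs-connectivity Y (Complete 3) (Path 2) 5≤n Y⊇ connected)
                 , (λ Y⊇ → union-obstructs-connectivity Y (Path 3) (Path 2) 5≤n Y⊇ connected) ]′)
  (λ free → Sorting.connected Y 5≤n
    (five-connected Y 5≤n (λ v → subst (_≤ degree Y v) δ≡n∸4 (δ≤degree Y v)) free))
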